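{- Fix $k\geq 3$ and $\ell\geq 4$, and let $n\geq 10k^2\ell$. Then \[ \mathrm{sat}_k(n,\text{Berge- }K_\ell)\leq \frac{\ell-2}{k-1}\,n+\binom{\ell}{2}-1. \]
   Context: A hypergraph $\mathcal{H}$ is a Berge-$F$ (for a graph $F$) if $F$ and $\mathcal{H}$ can be embedded on a common vertex set with a bijection $\phi:E(F)\to E(\mathcal{H})$ such that $e\subseteq\phi(e)$ for every $e\in E(F)$; a hypergraph contains a Berge-$F$ if some subset of its edges forms one. A $k$-uniform hypergraph $\mathcal{H}$ is Berge-$F$-saturated if it contains no Berge-$F$, but $\mathcal{H}+e$ contains a Berge-$F$ for every $k$-set $e\subseteq V(\mathcal{H})$ with $e\notin E(\mathcal{H})$. $\mathrm{sat}_k(n,\text{Berge- }F)$ is the minimum number of edges in a Berge-$F$-saturated $k$-uniform hypergraph on $n$ vertices. -}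

module Defs where

open import Data.Nat using (ℕ; _+_; _*_; _∸_; _≤_; _≥_)
open import Data.Nat.Combinatorics using (_C_)
open import Data.Fin using (Fin; _<_)
open import Data.Fin.Subset using (Subset; ∣_∣) renaming (_∈_ to _∈ᵥ_)
open import Data.List using (List; _∷_; length; lookup)
open import Data.List.Relation.Unary.All using (All)
open import Data.List.Relation.Unary.Unique.Propositional using (Unique)
open import Data.List.Membership.Propositional using (_∉_)
open import Data.Product using (Σ; _×_)
open import Function.Definitions using (Injective)
open import Relation.Binary.PropositionalEquality using (_≡_)
open import Relation.Nullary using (¬_)

record UniformHypergraph (k n : ℕ) : Set where
  field
    edges    : List (Subset n)
    uniform  : All (λ e → ∣ e ∣ ≡ k) edges
    distinct : Unique edges
open UniformHypergraph public

-- The edge list E contains a Berge-K_ℓ: there are ℓ distinct vertices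
-- v 0,…,v (ℓ-1) and an injective assignment φ of the pairs {i,j} (i < j)
-- of K_ℓ to edges of E (given by list position; E is duplicate-free in use)
-- with v i, v j ∈ φ(i,j).
ContainsBergeK : {n : ℕ} → ℕ → List (Subset n) → Set
ContainsBergeK {n} ℓ E =
  Σ (Fin ℓ → Fin n) λ v →
    Injective _≡_ _≡_ v ×
    Σ ((i j : Fin ℓ) → i < j → Fin (length E)) λ φ →
      (∀ i j (p : i < j) i′ j′ (p′ : i′ < j′) →
         φ i j p ≡ φ i′ j′ p′ → (i ≡ i′ × j ≡ j′)) ×
      (∀ i j (p : i < j) →
         (v i ∈ᵥ lookup E (φ i j p)) × (v j ∈ᵥ lookup E (φ i j p)))

BergeKSaturated : {k n : ℕ} → ℕ → UniformHypergraph k n → Set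
BergeKSaturated {k} {n} ℓ H =
  ¬ ContainsBergeK ℓ (edges H) ×
  (∀ (e : Subset n) → ∣ e ∣ ≡ k → e ∉ edges H → ContainsBergeK ℓ (e ∷ edges H))

-- sat_k(n, Berge-K_ℓ) ≤ (ℓ-2)/(k-1) n + C(ℓ,2) - 1, with the denominator
-- cleared: some saturated H has m edges with
-- (k-1) m ≤ (ℓ-2) n + (k-1)(C(ℓ,2) - 1).
SatUpperBound : ℕ → ℕ → ℕ → Set
SatUpperBound k ℓ n =
  Σ (UniformHypergraph k n) λ H →
    BergeKSaturated ℓ H ×
    (k ∸ 1) * length (edges H) ≤ (ℓ ∸ 2) * n + (k ∸ 1) * ((ℓ C 2) ∸ 1)

{-# OPTIONS --safe #-}

-- Write ℓ = r + 2 and split the vertices into r core vertices cᵢ, k spare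
-- vertices 0, 1, 2, … and the remaining outer ones, which are covered by groups of
-- size k − 1 with a single overlap between the first two.  The edges are all stars
-- {cᵢ} ∪ group and the C(ℓ,2) − 1 core edges {cᵢ} ∪ spares∖{0},
-- {cᵢ} ∪ spares∖{1} and {cᵢ,cⱼ} ∪ spares∖{1,2}.
--
-- Outer vertices are adjacent to core and outer vertices only, so a Berge-K_ℓ with an
-- outer vertex has two of them; but two adjacent ones meet at most 2r edges, too few
-- for their 2r + 1 pairs.  As a star has only one vertex that is not outer, a Berge-K_ℓ
-- would then use core edges only, of which there is one too few.
--
-- Every spare vertex and every outer vertex is joined to all of the core, so a new edge
-- through two of them completes a clique on these and the core, except when both belong
-- to the same group.  A new edge through two core vertices replaces a core edge, and
-- shifting the core edges along closes the only gap.  Any other k-set is a star.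
module Submission where

open import Defs
open import Data.Nat as ℕ using (ℕ; zero; suc; _+_; _*_; _∸_; _≤_; _≥_; z≤n; s≤s)
import Data.Nat.Properties as ℕ
open import Data.Nat.Combinatorics using (_C_; nC1≡n; nCk+nC[k+1]≡[n+1]C[k+1])
open import Data.Nat.DivMod using (_/_; _%_; m≡m%n+[m/n]*n; m%n<n)
open import Data.Nat.Solver using (module +-*-Solver)
open import Data.Fin as Fin using (Fin; zero; suc; toℕ; fromℕ<; _<_; _↑ˡ_; _↑ʳ_; punchIn; splitAt;
  remQuot; combine)
open import Data.Fin.Properties as Fin
  using (toℕ<n; toℕ-fromℕ<; suc-injective; ↑ˡ-injective; ↑ʳ-injective;
         join-splitAt; toℕ-↑ˡ; toℕ-↑ʳ; combine-remQuot; toℕ-combine;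
         punchIn-injective; punchInᵢ≢i; any?; injective⇒≤; <-cmp; _≟_)
open import Data.Fin.Subset using (Subset; ∣_∣; ⊥; ⊤; ⁅_⁆; _∪_; _⊆_; inside; outside)
  renaming (_∈_ to _∈ᵥ_; _∉_ to _∉ᵥ_)
open import Data.Fin.Subset.Properties
  using (∣⊥∣≡0; ∣⊤∣≡n; ∣⁅x⁆∣≡1; ∈⊤; ∉⊥; x∈⁅x⁆; x∈⁅y⁆⇒x≡y; x∈p∪q⁺; x∈p∪q⁻; ⊆-antisym;
         _⊆?_; _∈?_; p⊂q⇒∣p∣<∣q∣)
open import Data.Vec as Vec using (_∷_; []; here; there)
import Data.Vec.Properties as Vec
open import Data.List as List using (List; []; _∷_; _++_; length; lookup; map; allFin; drop; cartesianProduct)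
open import Data.List.Properties using (length-map; length-++; length-tabulate)
open import Data.List.Membership.Propositional using (_∈_; _∉_)
open import Data.List.Membership.Propositional.Properties
  using (∈-lookup; ∈-map⁺; ∈-map⁻; ∈-++⁺ˡ; ∈-++⁺ʳ; ∈-++⁻; ∈-allFin; ∈-cartesianProduct⁺; ∈-cartesianProduct⁻)
open import Data.List.Relation.Unary.All as All using (All; []; _∷_)
import Data.List.Relation.Unary.All.Properties as All
open import Data.List.Relation.Unary.Any as Any using (here; there)
open import Data.List.Relation.Unary.Any.Properties using (lookup-index)
open import Data.List.Relation.Unary.AllPairs using ([]; _∷_)
open import Data.List.Relation.Unary.Unique.Propositional using (Unique)
import Data.List.Relation.Unary.Unique.Propositional.Properties as Unique
open import Data.Maybe using (Maybe; just; nothing; maybe′)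
open import Data.Maybe.Properties using (just-injective)
open import Data.Product using (Σ; ∃; ∃₂; _×_; _,_; proj₁; proj₂)
open import Data.Sum using (_⊎_; inj₁; inj₂)
open import Function using (_∘_; case_of_)
open import Function.Definitions using (Injective)
open import Relation.Binary using (tri<; tri≈; tri>)
open import Relation.Binary.PropositionalEquality
open import Relation.Nullary using (¬_; Dec; yes; no; contradiction)
import Relation.Nullary.Decidable as Dec

-- Duplicate-free lists and counting by injective relations

module _ {a} {A : Set a} where

  lookup-injective : {xs : List A} → Unique xs → Injective _≡_ _≡_ (lookup xs)
  lookup-injective (_ ∷ _)   {zero}  {zero}  _  = refl
  lookup-injective (x∉ ∷ _)  {zero}  {suc j} eq = contradiction eq (All.lookup x∉ (∈-lookup j))
  lookup-injective (x∉ ∷ _)  {suc i} {zero}  eq = contradiction (sym eq) (All.lookup x∉ (∈-lookup i))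
  lookup-injective (_ ∷ xs!) {suc i} {suc j} eq = cong suc (lookup-injective xs! eq)

  module _ {b} {B : Set b} where

    -- Injectivity is asked on members of `xs` only, because `edge` is injective on the labels in
    -- `indices` but not on all labels.
    map⁺-∈ : {f : A → B} {xs : List A} →
             (∀ {x y} → x ∈ xs → y ∈ xs → f x ≡ f y → x ≡ y) → Unique xs → Unique (map f xs)
    map⁺-∈ inj []         = []
    map⁺-∈ inj (x∉ ∷ xs!) =
      All.map⁺ (All.tabulate λ y∈ eq → All.lookup x∉ y∈ (inj (here refl) (there y∈) eq))
      ∷ map⁺-∈ (λ x∈ y∈ → inj (there x∈) (there y∈)) xs!

    -- Sending each position of `xs` to the position of a related member of `ys` is injective, so
    -- the pigeonhole principle applies. A relation is used because the label of a pair depends on a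
    -- proof of `i < j`, which the relation can carry.
    injective-relation⇒≤ : ∀ {ℓ} {R : A → B → Set ℓ} {xs ys} → Unique xs →
      (∀ {x x′ y} → R x y → R x′ y → x ≡ x′) →
      (∀ {x} → x ∈ xs → ∃ λ y → y ∈ ys × R x y) → length xs ≤ length ys
    injective-relation⇒≤ {R = R} {xs} {ys} xs! inj total = injective⇒≤ f-injective
      where
      image : ∀ i → ∃ λ y → y ∈ ys × R (lookup xs i) y
      image i = total (∈-lookup i)

      f : Fin (length xs) → Fin (length ys)
      f i = Any.index (proj₁ (proj₂ (image i)))

      f-injective : Injective _≡_ _≡_ f
      f-injective {i} {j} eq = lookup-injective xs! (inj (proj₂ (proj₂ (image i)))
        (subst (R _) (sym y≡y′) (proj₂ (proj₂ (image j)))))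
        where
        y≡y′ : proj₁ (image i) ≡ proj₁ (image j)
        y≡y′ = trans (lookup-index (proj₁ (proj₂ (image i))))
          (trans (cong (lookup ys) eq) (sym (lookup-index (proj₁ (proj₂ (image j))))))

length-cartesianProduct : ∀ {a b} {A : Set a} {B : Set b} (xs : List A) (ys : List B) →
  length (cartesianProduct xs ys) ≡ length xs * length ys
length-cartesianProduct []       ys = refl
length-cartesianProduct (x ∷ xs) ys = trans (length-++ (map (x ,_) ys))
  (cong₂ _+_ (length-map (x ,_) ys) (length-cartesianProduct xs ys))

-- Enumeration of the increasing pairs

suc² : ∀ {n} → Fin n × Fin n → Fin (suc n) × Fin (suc n)
suc² (i , j) = suc i , suc j

pairs : ∀ n → List (Fin n × Fin n)
pairs zero    = []
pairs (suc n) = map (zero ,_) (map suc (allFin n)) ++ map suc² (pairs n)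

length-pairs : ∀ n → length (pairs n) ≡ n C 2
length-pairs zero    = refl
length-pairs (suc n) = begin
  length (pairs (suc n))             ≡⟨ length-++ (map (zero ,_) (map suc (allFin n))) ⟩
  length (map (zero ,_) (map suc (allFin n))) + length (map suc² (pairs n))
    ≡⟨ cong₂ _+_ (trans (length-map (zero ,_) (map suc (allFin n)))
                        (trans (length-map suc (allFin n)) (length-tabulate {n = n} (λ i → i))))
                 (trans (length-map suc² (pairs n)) (length-pairs n)) ⟩
  n + n C 2                          ≡⟨ cong (_+ n C 2) (sym (nC1≡n n)) ⟩
  n C 1 + n C 2                      ≡⟨ nCk+nC[k+1]≡[n+1]C[k+1] n 1 ⟩
  suc n C 2                          ∎
  where open ≡-Reasoning

∈-pairs⁺ : ∀ {n} {i j : Fin n} → i < j → (i , j) ∈ pairs n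
∈-pairs⁺ {suc n} {zero}  {suc j} _         = ∈-++⁺ˡ (∈-map⁺ (zero ,_) (∈-map⁺ suc (∈-allFin j)))
∈-pairs⁺ {suc n} {suc i} {suc j} (s≤s i<j) = ∈-++⁺ʳ _ (∈-map⁺ suc² (∈-pairs⁺ i<j))

∈-pairs⁻ : ∀ {n} {i j : Fin n} → (i , j) ∈ pairs n → i < j
∈-pairs⁻ {suc n} ij∈ with ∈-++⁻ (map (zero ,_) (map suc (allFin n))) ij∈
... | inj₁ p with ∈-map⁻ (zero ,_) p
...   | _ , q , refl with ∈-map⁻ suc q
...     | _ , _ , refl = s≤s z≤n
∈-pairs⁻ {suc n} ij∈ | inj₂ p with ∈-map⁻ suc² p
... | _ , q , refl = s≤s (∈-pairs⁻ q)

pairs-unique : ∀ n → Unique (pairs n)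
pairs-unique zero    = []
pairs-unique (suc n) = Unique.++⁺
  (Unique.map⁺ (cong proj₂) (Unique.map⁺ suc-injective (Unique.allFin⁺ n)))
  (Unique.map⁺ (λ { refl → refl }) (pairs-unique n))
  λ (p , q) → disjoint p q
  where
  disjoint : ∀ {x} → x ∈ map (zero ,_) (map suc (allFin n)) → ¬ (x ∈ map suc² (pairs n))
  disjoint p q with ∈-map⁻ (zero ,_) p | ∈-map⁻ suc² q
  ... | _ , _ , refl | _ , _ , ()

-- Subsets: concatenation, singletons and pairs, sizes

∈-++⁺ˡᵛ : ∀ {m n i} {a : Subset m} (b : Subset n) → i ∈ᵥ a → i ↑ˡ n ∈ᵥ a Vec.++ b
∈-++⁺ˡᵛ b here      = here
∈-++⁺ˡᵛ b (there p) = there (∈-++⁺ˡᵛ b p)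

∈-++⁻ˡᵛ : ∀ {m n} {i} (a : Subset m) {b : Subset n} → i ↑ˡ n ∈ᵥ a Vec.++ b → i ∈ᵥ a
∈-++⁻ˡᵛ {i = zero}  (_ ∷ a) here      = here
∈-++⁻ˡᵛ {i = suc i} (_ ∷ a) (there p) = there (∈-++⁻ˡᵛ a p)

∈-++⁺ʳᵛ : ∀ {m n i} (a : Subset m) {b : Subset n} → i ∈ᵥ b → m ↑ʳ i ∈ᵥ a Vec.++ b
∈-++⁺ʳᵛ []      p = p
∈-++⁺ʳᵛ (_ ∷ a) p = there (∈-++⁺ʳᵛ a p)

∈-++⁻ʳᵛ : ∀ {m n i} (a : Subset m) {b : Subset n} → m ↑ʳ i ∈ᵥ a Vec.++ b → i ∈ᵥ b
∈-++⁻ʳᵛ []      p         = p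
∈-++⁻ʳᵛ (_ ∷ a) (there p) = ∈-++⁻ʳᵛ a p

∣++∣ : ∀ {m n} (a : Subset m) (b : Subset n) → ∣ a Vec.++ b ∣ ≡ ∣ a ∣ + ∣ b ∣
∣++∣ []            b = refl
∣++∣ (inside  ∷ a) b = cong suc (∣++∣ a b)
∣++∣ (outside ∷ a) b = ∣++∣ a b

∣⊥∪p∣ : ∀ {n} (p : Subset n) → ∣ ⊥ ∪ p ∣ ≡ ∣ p ∣
∣⊥∪p∣ []            = refl
∣⊥∪p∣ (inside  ∷ p) = cong suc (∣⊥∪p∣ p)
∣⊥∪p∣ (outside ∷ p) = ∣⊥∪p∣ p

∣⁅i⁆∪⁅j⁆∣≡2 : ∀ {n} {i j : Fin n} → i < j → ∣ ⁅ i ⁆ ∪ ⁅ j ⁆ ∣ ≡ 2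
∣⁅i⁆∪⁅j⁆∣≡2 {suc n} {zero}  {suc j} _         = cong suc (trans (∣⊥∪p∣ ⁅ j ⁆) (∣⁅x⁆∣≡1 j))
∣⁅i⁆∪⁅j⁆∣≡2 {suc n} {suc i} {suc j} (s≤s i<j) = ∣⁅i⁆∪⁅j⁆∣≡2 i<j

-- Distinctness excludes matching `i` and `j` with the same element, and the order excludes the
-- swapped match.
∪-pair-injective : ∀ {n} {i j i′ j′ : Fin n} → i < j → i′ < j′ →
  ⁅ i ⁆ ∪ ⁅ j ⁆ ≡ ⁅ i′ ⁆ ∪ ⁅ j′ ⁆ → i ≡ i′ × j ≡ j′
∪-pair-injective {i = i} {j} {i′} {j′} i<j i′<j′ eq with
     x∈p∪q⁻ ⁅ i′ ⁆ ⁅ j′ ⁆ (subst (i ∈ᵥ_) eq (x∈p∪q⁺ (inj₁ (x∈⁅x⁆ i))))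
   | x∈p∪q⁻ ⁅ i′ ⁆ ⁅ j′ ⁆ (subst (j ∈ᵥ_) eq (x∈p∪q⁺ (inj₂ (x∈⁅x⁆ j))))
... | inj₁ p | inj₂ q = x∈⁅y⁆⇒x≡y _ p , x∈⁅y⁆⇒x≡y _ q
... | inj₁ p | inj₁ q = contradiction (trans (x∈⁅y⁆⇒x≡y _ p) (sym (x∈⁅y⁆⇒x≡y _ q))) (Fin.<⇒≢ i<j)
... | inj₂ p | inj₂ q = contradiction (trans (x∈⁅y⁆⇒x≡y _ p) (sym (x∈⁅y⁆⇒x≡y _ q))) (Fin.<⇒≢ i<j)
... | inj₂ p | inj₁ q with refl ← x∈⁅y⁆⇒x≡y _ p | refl ← x∈⁅y⁆⇒x≡y _ q = contradiction i<j (ℕ.<⇒≯ i′<j′)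

⁅⁆-injective : ∀ {n} {i j : Fin n} → ⁅ i ⁆ ≡ ⁅ j ⁆ → i ≡ j
⁅⁆-injective {i = i} {j} eq = x∈⁅y⁆⇒x≡y j (subst (i ∈ᵥ_) eq (x∈⁅x⁆ i))

-- `many` records just two members, since two suitable vertices of a new edge are all that a clique
-- needs.
data Size {n} : Subset n → Set where
  empty     : Size ⊥
  singleton : ∀ i → Size ⁅ i ⁆
  many      : ∀ {p i j} → i < j → i ∈ᵥ p → j ∈ᵥ p → Size p

size : ∀ {n} (p : Subset n) → Size p
size []            = empty
size (outside ∷ p) with size p
... | empty         = empty
... | singleton i   = singleton (suc i)
... | many i<j i∈ j∈ = many (s≤s i<j) (there i∈) (there j∈)
size (inside ∷ p) with size p
... | empty         = singleton zero
... | singleton i   = many (s≤s z≤n) here (there (x∈⁅x⁆ i))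
... | many i<j i∈ j∈ = many (s≤s z≤n) here (there i∈)

-- A member of `q` outside `p` would make the inclusion proper and `p` strictly smaller.
⊆∧∣≥∣⇒≡ : ∀ {n} {p q : Subset n} → p ⊆ q → ∣ q ∣ ≤ ∣ p ∣ → p ≡ q
⊆∧∣≥∣⇒≡ {p = p} {q} p⊆q q≤p with q ⊆? p
... | yes q⊆p = ⊆-antisym p⊆q q⊆p
... | no  q⊈p with any? (λ x → (x ∈? q) Dec.×-dec Dec.¬? (x ∈? p))
...   | yes x  = contradiction (p⊂q⇒∣p∣<∣q∣ (p⊆q , x)) (ℕ.≤⇒≯ q≤p)
...   | no  ∄x = contradiction (λ {x} x∈q → Dec.decidable-stable (x ∈? p) λ x∉p → ∄x (x , x∈q , x∉p)) q⊈p

-- Intervals, and the covering of the outer vertices by groups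

window : (s q n : ℕ) → Subset n
window _       _       zero    = []
window (suc s) q       (suc n) = outside ∷ window s q n
window zero    (suc q) (suc n) = inside ∷ window zero q n
window zero    zero    (suc n) = ⊥

∣window∣ : ∀ s q n → s + q ≤ n → ∣ window s q n ∣ ≡ q
∣window∣ zero    zero    zero    _         = refl
∣window∣ (suc s) q       (suc n) (s≤s s+q≤n) = ∣window∣ s q n s+q≤n
∣window∣ zero    (suc q) (suc n) (s≤s q≤n) = cong suc (∣window∣ zero q n q≤n)
∣window∣ zero    zero    (suc n) _         = ∣⊥∣≡0 n

∈-window⁺ : ∀ s q {n} {x : Fin n} → s ≤ toℕ x → toℕ x ℕ.< s + q → x ∈ᵥ window s q n
∈-window⁺ (suc s) q       {x = suc x} (s≤s s≤x) (s≤s x<) = there (∈-window⁺ s q s≤x x<)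
∈-window⁺ zero    (suc q) {x = zero}  _         _        = here
∈-window⁺ zero    (suc q) {x = suc x} _         (s≤s x<) = there (∈-window⁺ zero q z≤n x<)

∈-window⁻ : ∀ s q {n} {x : Fin n} → x ∈ᵥ window s q n → s ≤ toℕ x × toℕ x ℕ.< s + q
∈-window⁻ (suc s) q       {x = suc x} (there x∈) with s≤x , x< ← ∈-window⁻ s q x∈ = s≤s s≤x , s≤s x<
∈-window⁻ zero    (suc q) {x = zero}  _          = z≤n , s≤s z≤n
∈-window⁻ zero    (suc q) {x = suc x} (there x∈) = z≤n , s≤s (proj₂ (∈-window⁻ zero q x∈))
∈-window⁻ zero    zero    {suc n}     x∈         = contradiction x∈ ∉⊥

-- Groups 1, 2, … partition all but the first ρ′ + 1 points; group 0 contains these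
-- and is filled up to size q with points of group 1.
module Groups (q m ρ′ : ℕ) (ρ′<q : ρ′ ℕ.< q) where

  w : ℕ
  w = suc ρ′ + suc m * q

  -- The initial stretch has `suc ρ′` points, at least one and at most `q`: so group 0 starts
  -- strictly before group 1, yet covers the whole stretch.
  start : Fin (suc (suc m)) → ℕ
  start zero    = 0
  start (suc j) = suc ρ′ + toℕ j * q

  group : Fin (suc (suc m)) → Subset w
  group j = window (start j) q w

  start+q≤w : ∀ j → start j + q ≤ w
  start+q≤w zero    = ℕ.≤-trans (ℕ.m≤m+n q (m * q)) (ℕ.m≤n+m (suc m * q) (suc ρ′))
  start+q≤w (suc j) = begin
    suc ρ′ + toℕ j * q + q     ≡⟨ ℕ.+-assoc (suc ρ′) (toℕ j * q) q ⟩
    suc ρ′ + (toℕ j * q + q)   ≡⟨ cong (suc ρ′ +_) (ℕ.+-comm (toℕ j * q) q) ⟩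
    suc ρ′ + suc (toℕ j) * q   ≤⟨ ℕ.+-monoʳ-≤ (suc ρ′) (ℕ.*-monoˡ-≤ q (toℕ<n j)) ⟩
    w                          ∎
    where open ℕ.≤-Reasoning

  ∣group∣ : ∀ j → ∣ group j ∣ ≡ q
  ∣group∣ j = ∣window∣ (start j) q w (start+q≤w j)

  0<q : 0 ℕ.< q
  0<q = ℕ.≤-<-trans z≤n ρ′<q

  start<w : ∀ j → start j ℕ.< w
  start<w j = ℕ.<-≤-trans (ℕ.m<m+n (start j) 0<q) (start+q≤w j)

  first : Fin (suc (suc m)) → Fin w
  first j = fromℕ< (start<w j)

  first∈group : ∀ j → first j ∈ᵥ group j
  first∈group j = ∈-window⁺ (start j) q (ℕ.≤-reflexive (sym (toℕ-fromℕ< (start<w j))))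
    (subst (ℕ._< start j + q) (sym (toℕ-fromℕ< (start<w j))) (ℕ.m<m+n (start j) 0<q))

  -- A point of the initial stretch lies in group 0; for any other point, the quotient by `q` of its
  -- distance from the end of the stretch names the group.
  covered : ∀ x → ∃ λ j → x ∈ᵥ group j
  covered x with splitAt (suc ρ′) x | join-splitAt (suc ρ′) (suc m * q) x
  ... | inj₁ y | refl = zero , ∈-window⁺ 0 q z≤n
    (subst (ℕ._< q) (sym (toℕ-↑ˡ y _)) (ℕ.<-≤-trans (toℕ<n y) ρ′<q))
  ... | inj₂ y | refl = suc b , ∈-window⁺ (start (suc b)) q
      (subst (start (suc b) ≤_) (sym x≡) (ℕ.m≤m+n (start (suc b)) _))
      (subst (ℕ._< start (suc b) + q) (sym x≡) (ℕ.+-monoʳ-< (start (suc b)) (toℕ<n c)))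
    where
    b = proj₁ (remQuot {suc m} q y)
    c = proj₂ (remQuot {suc m} q y)
    x≡ : toℕ (suc ρ′ ↑ʳ y) ≡ start (suc b) + toℕ c
    x≡ = begin
      toℕ (suc ρ′ ↑ʳ y)                 ≡⟨ toℕ-↑ʳ (suc ρ′) y ⟩
      suc ρ′ + toℕ y                    ≡⟨ cong (λ z → suc ρ′ + toℕ z) (sym (combine-remQuot {suc m} q y)) ⟩
      suc ρ′ + toℕ (combine b c)        ≡⟨ cong (suc ρ′ +_) (toℕ-combine b c) ⟩
      suc ρ′ + (q * toℕ b + toℕ c)      ≡⟨ cong (λ z → suc ρ′ + (z + toℕ c)) (ℕ.*-comm q (toℕ b)) ⟩
      suc ρ′ + (toℕ b * q + toℕ c)      ≡⟨ sym (ℕ.+-assoc (suc ρ′) (toℕ b * q) (toℕ c)) ⟩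
      start (suc b) + toℕ c             ∎
      where open ≡-Reasoning

  later-start : ∀ {i j : Fin (suc m)} → i < j → start (suc i) + q ≤ start (suc j)
  later-start {i} {j} i<j = begin
    suc ρ′ + toℕ i * q + q     ≡⟨ ℕ.+-assoc (suc ρ′) (toℕ i * q) q ⟩
    suc ρ′ + (toℕ i * q + q)   ≡⟨ cong (suc ρ′ +_) (ℕ.+-comm (toℕ i * q) q) ⟩
    suc ρ′ + suc (toℕ i) * q   ≤⟨ ℕ.+-monoʳ-≤ (suc ρ′) (ℕ.*-monoˡ-≤ q i<j) ⟩
    suc ρ′ + toℕ j * q         ∎
    where open ℕ.≤-Reasoning

  later-disjoint : ∀ {i j x} → i < j → x ∈ᵥ group (suc i) → x ∉ᵥ group (suc j)
  later-disjoint i<j x∈i x∈j = ℕ.<⇒≱ (proj₂ (∈-window⁻ _ q x∈i))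
    (ℕ.≤-trans (later-start i<j) (proj₁ (∈-window⁻ _ q x∈j)))

  block-unique : ∀ {i j x} → x ∈ᵥ group (suc i) → x ∈ᵥ group (suc j) → i ≡ j
  block-unique {i} {j} x∈i x∈j with <-cmp i j
  ... | tri< i<j _ _ = contradiction x∈j (later-disjoint i<j x∈i)
  ... | tri≈ _ i≡j _ = i≡j
  ... | tri> _ _ j<i = contradiction x∈i (later-disjoint j<i x∈j)

  -- The later groups are nonempty and disjoint, and none of them contains the point 0, which
  -- belongs to group 0.
  group-injective : ∀ {i j} → group i ≡ group j → i ≡ j
  group-injective {zero}  {zero}  _  = refl
  group-injective {suc i} {suc j} eq = cong suc (block-unique (first∈group (suc i))
    (subst (first (suc i) ∈ᵥ_) eq (first∈group (suc i))))
  group-injective {zero}  {suc j} eq =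
    case proj₁ (∈-window⁻ (start (suc j)) q (subst (first zero ∈ᵥ_) eq (first∈group zero))) of λ ()
  group-injective {suc i} {zero}  eq =
    case proj₁ (∈-window⁻ (start (suc i)) q (subst (first zero ∈ᵥ_) (sym eq) (first∈group zero))) of λ ()

  -- Two outer vertices in a common group thus see at most two groups between them. The partner of
  -- every later group is group 0, even where the two are disjoint; the partner of group 0 is group
  -- 1, since its `q` points end before group 2 starts.
  overlapping : ∀ j → ∃ λ j′ → ∀ {x} → x ∈ᵥ group j → ∀ {i} → x ∈ᵥ group i → i ≡ j ⊎ i ≡ j′
  overlapping (suc j) = zero , λ where
    x∈j {zero}  _   → inj₂ refl
    x∈j {suc i} x∈i → inj₁ (cong suc (block-unique x∈i x∈j))
  overlapping zero = suc zero , λ where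
    x∈ {zero}        _   → inj₁ refl
    x∈ {suc zero}    _   → inj₂ refl
    x∈ {suc (suc i)} x∈i → contradiction (proj₂ (∈-window⁻ 0 q x∈)) (ℕ.≤⇒≯ (let open ℕ.≤-Reasoning in begin
      q                              ≤⟨ ℕ.m≤m+n q (toℕ i * q) ⟩
      q + toℕ i * q                  ≤⟨ ℕ.m≤n+m _ (suc ρ′) ⟩
      suc ρ′ + (q + toℕ i * q)       ≤⟨ proj₁ (∈-window⁻ _ q x∈i) ⟩
      _                              ∎))


-- The hypergraph: vertices, edge labels and edges

module Construction (r k′ m ρ′ : ℕ) (ρ′<q : ρ′ ℕ.< 2 + k′) where

  q k ℓ : ℕ
  q = 2 + k′
  k = suc q
  ℓ = 2 + r

  open Groups q m ρ′ ρ′<q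

  n : ℕ
  n = r + (k + w)

  coreV : Fin r → Fin n
  coreV i = i ↑ˡ (k + w)

  spareV : Fin k → Fin n
  spareV x = r ↑ʳ (x ↑ˡ w)

  outerV : Fin w → Fin n
  outerV y = r ↑ʳ (k ↑ʳ y)

  data Vertex : Fin n → Set where
    core  : ∀ i → Vertex (coreV i)
    spare : ∀ x → Vertex (spareV x)
    outer : ∀ y → Vertex (outerV y)

  vertex : ∀ z → Vertex z
  vertex z with splitAt r z | join-splitAt r (k + w) z
  ... | inj₁ i | refl = core i
  ... | inj₂ u | refl with splitAt k u | join-splitAt k w u
  ...   | inj₁ x | refl = spare x
  ...   | inj₂ y | refl = outer y

  coreV-injective : Injective _≡_ _≡_ coreV
  coreV-injective = ↑ˡ-injective (k + w) _ _

  spareV-injective : Injective _≡_ _≡_ spareV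
  spareV-injective eq = ↑ˡ-injective w _ _ (↑ʳ-injective r _ _ eq)

  ↑ˡ≢↑ʳ : ∀ {a b} (i : Fin a) (j : Fin b) → i ↑ˡ b ≢ a ↑ʳ j
  ↑ˡ≢↑ʳ zero    j ()
  ↑ˡ≢↑ʳ (suc i) j eq = ↑ˡ≢↑ʳ i j (suc-injective eq)

  outerV-injective : Injective _≡_ _≡_ outerV
  outerV-injective eq = ↑ʳ-injective k _ _ (↑ʳ-injective r _ _ eq)

  core≢spare : ∀ i x → coreV i ≢ spareV x
  core≢spare i x = ↑ˡ≢↑ʳ i (x ↑ˡ w)

  core≢outer : ∀ i y → coreV i ≢ outerV y
  core≢outer i y = ↑ˡ≢↑ʳ i (k ↑ʳ y)

  spare≢outer : ∀ x y → spareV x ≢ outerV y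
  spare≢outer x y eq = ↑ˡ≢↑ʳ x y (↑ʳ-injective r _ _ eq)

  opaque

    -- Every vertex set splits uniquely into a core, a spare and an outer part; later arguments see
    -- sets through these parts only, hence the opacity.
    glue : Subset r → Subset k → Subset w → Subset n
    glue a b c = a Vec.++ (b Vec.++ c)

    glue-injective : ∀ {a a′ b b′ c c′} → glue a b c ≡ glue a′ b′ c′ → a ≡ a′ × b ≡ b′ × c ≡ c′
    glue-injective {a} {a′} {b} {b′} eq with a≡ , bc≡ ← Vec.++-injective a a′ eq =
      a≡ , Vec.++-injective b b′ bc≡

    ∣glue∣ : ∀ a b c → ∣ glue a b c ∣ ≡ ∣ a ∣ + (∣ b ∣ + ∣ c ∣)
    ∣glue∣ a b c = trans (∣++∣ a (b Vec.++ c)) (cong (∣ a ∣ +_) (∣++∣ b c))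

    core∈⁺ : ∀ {a b c i} → i ∈ᵥ a → coreV i ∈ᵥ glue a b c
    core∈⁺ = ∈-++⁺ˡᵛ _

    core∈⁻ : ∀ {a b c i} → coreV i ∈ᵥ glue a b c → i ∈ᵥ a
    core∈⁻ {a} = ∈-++⁻ˡᵛ a

    spare∈⁺ : ∀ {a b c x} → x ∈ᵥ b → spareV x ∈ᵥ glue a b c
    spare∈⁺ {a} p = ∈-++⁺ʳᵛ a (∈-++⁺ˡᵛ _ p)

    spare∈⁻ : ∀ {a b c x} → spareV x ∈ᵥ glue a b c → x ∈ᵥ b
    spare∈⁻ {a} {b} p = ∈-++⁻ˡᵛ b (∈-++⁻ʳᵛ a p)

    outer∈⁺ : ∀ {a b c y} → y ∈ᵥ c → outerV y ∈ᵥ glue a b c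
    outer∈⁺ {a} {b} p = ∈-++⁺ʳᵛ a (∈-++⁺ʳᵛ b p)

    outer∈⁻ : ∀ {a b c y} → outerV y ∈ᵥ glue a b c → y ∈ᵥ c
    outer∈⁻ {a} {b} p = ∈-++⁻ʳᵛ b (∈-++⁻ʳᵛ a p)

    unglue : ∀ e → ∃ λ a → ∃₂ λ b c → e ≡ glue a b c
    unglue e with a , bc , refl ← Vec.splitAt r e with b , c , refl ← Vec.splitAt k bc = a , b , c , refl

  -- Of two distinct spare vertices, one lies in `spares∖0` and the other in `spares∖1`. Spare 0 is
  -- kept in `spares∖12` so that an edge on two core vertices can stand in for one of the second
  -- kind.
  spares∖0 spares∖1 spares∖12 : Subset k
  spares∖0  = outside ∷ inside ∷ inside ∷ ⊤
  spares∖1  = inside ∷ outside ∷ inside ∷ ⊤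
  spares∖12 = inside ∷ outside ∷ outside ∷ ⊤

  -- A core edge is named by the pair of clique positions that it is meant to join: 0 and 1 stand
  -- for two non-core vertices, `2 + i` for the core vertex `i`. A star is named by its core vertex
  -- and its group.
  Index : Set
  Index = (Fin ℓ × Fin ℓ) ⊎ (Fin r × Fin (2 + m))

  -- The pair (0 , 1) labels no edge: its value is junk.
  edge : Index → Subset n
  edge (inj₁ (zero , suc (suc i)))        = glue ⁅ i ⁆ spares∖0 ⊥
  edge (inj₁ (suc zero , suc (suc i)))    = glue ⁅ i ⁆ spares∖1 ⊥
  edge (inj₁ (suc (suc i) , suc (suc j))) = glue (⁅ i ⁆ ∪ ⁅ j ⁆) spares∖12 ⊥
  edge (inj₁ _)                           = ⊥
  edge (inj₂ (i , g))                     = glue ⁅ i ⁆ ⊥ (group g)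

  -- The head of `pairs ℓ` is `(zero , suc zero)`, the one pair left without an edge.
  corePairs : List (Fin ℓ × Fin ℓ)
  corePairs = drop 1 (pairs ℓ)

  stars : List (Fin r × Fin (2 + m))
  stars = cartesianProduct (allFin r) (allFin (2 + m))

  indices : List Index
  indices = map inj₁ corePairs ++ map inj₂ stars

  ∈-corePairs⁺ : ∀ {i j} → i < j → (i , j) ≢ (zero , suc zero) → (i , j) ∈ corePairs
  ∈-corePairs⁺ i<j ≢01 with ∈-pairs⁺ i<j
  ... | here eq  = contradiction eq ≢01
  ... | there ij∈ = ij∈

  pair∈ : ∀ {i j} → i < j → (i , j) ≢ (zero , suc zero) → inj₁ (i , j) ∈ indices
  pair∈ i<j ≢01 = ∈-++⁺ˡ (∈-map⁺ inj₁ (∈-corePairs⁺ i<j ≢01))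

  star∈ : ∀ i g → inj₂ (i , g) ∈ indices
  star∈ i g = ∈-++⁺ʳ (map inj₁ corePairs) (∈-map⁺ inj₂ (∈-cartesianProduct⁺ (∈-allFin i) (∈-allFin g)))

  -- These are the kinds of label that occur in `indices`; matching on them avoids the junk values
  -- of `edge`.
  data View : Index → Set where
    left  : ∀ i → View (inj₁ (zero , suc (suc i)))
    right : ∀ i → View (inj₁ (suc zero , suc (suc i)))
    both    : ∀ {i j} → i < j → View (inj₁ (suc (suc i) , suc (suc j)))
    star    : ∀ i g → View (inj₂ (i , g))

  viewPair : ∀ i j → (i , j) ∈ corePairs → View (inj₁ (i , j))
  viewPair i j ij∈ with ∈-pairs⁻ {ℓ} (there ij∈)
  viewPair zero          (suc zero)    ij∈ | _ =
    contradiction ij∈ (Unique.Unique[x∷xs]⇒x∉xs (pairs-unique ℓ))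
  viewPair zero          (suc (suc j)) _   | _               = left j
  viewPair (suc zero)    (suc zero)    _   | s≤s ()
  viewPair (suc zero)    (suc (suc j)) _   | _               = right j
  viewPair (suc (suc i)) (suc zero)    _   | s≤s ()
  viewPair (suc (suc i)) (suc (suc j)) _   | s≤s (s≤s i<j)   = both i<j

  view : ∀ {x} → x ∈ indices → View x
  view x∈ with ∈-++⁻ (map inj₁ corePairs) x∈
  ... | inj₁ p with ((i , j) , ij∈ , refl) ← ∈-map⁻ inj₁ p = viewPair i j ij∈
  ... | inj₂ p with ((i , g) , _ , refl) ← ∈-map⁻ inj₂ p   = star i g

  ∣edge∣ : ∀ {x} → View x → ∣ edge x ∣ ≡ k
  ∣edge∣ (left i)  = trans (∣glue∣ ⁅ i ⁆ spares∖0 ⊥)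
    (cong₂ _+_ (∣⁅x⁆∣≡1 i) (trans (cong₂ (λ a b → 2 + a + b) (∣⊤∣≡n k′) (∣⊥∣≡0 w)) (ℕ.+-identityʳ q)))
  ∣edge∣ (right i) = trans (∣glue∣ ⁅ i ⁆ spares∖1 ⊥)
    (cong₂ _+_ (∣⁅x⁆∣≡1 i) (trans (cong₂ (λ a b → 2 + a + b) (∣⊤∣≡n k′) (∣⊥∣≡0 w)) (ℕ.+-identityʳ q)))
  ∣edge∣ (both {i} {j} i<j) = trans (∣glue∣ (⁅ i ⁆ ∪ ⁅ j ⁆) spares∖12 ⊥)
    (cong₂ _+_ (∣⁅i⁆∪⁅j⁆∣≡2 i<j) (trans (cong₂ (λ a b → 1 + a + b) (∣⊤∣≡n k′) (∣⊥∣≡0 w)) (ℕ.+-identityʳ (suc k′))))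
  ∣edge∣ (star i g)  = trans (∣glue∣ ⁅ i ⁆ ⊥ (group g))
    (cong₂ _+_ (∣⁅x⁆∣≡1 i) (cong₂ _+_ (∣⊥∣≡0 k) (∣group∣ g)))

  -- The spare part tells the four kinds apart. Within a kind the core part determines the label,
  -- together with the group in the case of stars.
  edge-injective : ∀ {x y} → View x → View y → edge x ≡ edge y → x ≡ y
  edge-injective vx vy eq = aux vx vy (split vx vy eq)
    where
    parts : ∀ {x} → View x → Subset r × Subset k × Subset w
    parts (left i)         = ⁅ i ⁆ , spares∖0 , ⊥
    parts (right i)        = ⁅ i ⁆ , spares∖1 , ⊥
    parts (both {i} {j} _)   = ⁅ i ⁆ ∪ ⁅ j ⁆ , spares∖12 , ⊥
    parts (star i g)         = ⁅ i ⁆ , ⊥ , group g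

    glue-parts : ∀ {x} (vx : View x) → edge x ≡ (let a , b , c = parts vx in glue a b c)
    glue-parts (left i)  = refl
    glue-parts (right i) = refl
    glue-parts (both _)    = refl
    glue-parts (star i g)  = refl

    Same : ∀ {x y} → View x → View y → Set
    Same vx vy = let a , b , c = parts vx ; a′ , b′ , c′ = parts vy in a ≡ a′ × b ≡ b′ × c ≡ c′

    split : ∀ {x y} (vx : View x) (vy : View y) → edge x ≡ edge y → Same vx vy
    split vx vy eq = glue-injective (trans (sym (glue-parts vx)) (trans eq (glue-parts vy)))

    aux : ∀ {x y} (vx : View x) (vy : View y) → Same vx vy → x ≡ y
    aux (left i)  (left j)  (eq , _)      = cong (λ i → inj₁ (zero , suc (suc i))) (⁅⁆-injective eq)
    aux (right i) (right j) (eq , _)      = cong (λ i → inj₁ (suc zero , suc (suc i))) (⁅⁆-injective eq)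
    aux (both p)    (both p′)   (eq , _) with refl , refl ← ∪-pair-injective p p′ eq = refl
    aux (star i g)  (star j h)  (eq , _ , eq′) = cong₂ (λ i g → inj₂ (i , g)) (⁅⁆-injective eq) (group-injective eq′)
    aux (left _)  (right _) (_ , () , _)
    aux (left _)  (both _)    (_ , () , _)
    aux (left _)  (star _ _)  (_ , () , _)
    aux (right _) (left _)  (_ , () , _)
    aux (right _) (both _)    (_ , () , _)
    aux (right _) (star _ _)  (_ , () , _)
    aux (both _)    (left _)  (_ , () , _)
    aux (both _)    (right _) (_ , () , _)
    aux (both _)    (star _ _)  (_ , () , _)
    aux (star _ _)  (left _)  (_ , () , _)
    aux (star _ _)  (right _) (_ , () , _)
    aux (star _ _)  (both _)    (_ , () , _)

  indices-unique : Unique indices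
  indices-unique = Unique.++⁺
    (Unique.map⁺ (λ { refl → refl }) (Unique.drop⁺ 1 (pairs-unique ℓ)))
    (Unique.map⁺ (λ { refl → refl }) (Unique.cartesianProduct⁺ (Unique.allFin⁺ r) (Unique.allFin⁺ (2 + m))))
    λ (p , p′) → disjoint p p′
    where
    disjoint : ∀ {x} → x ∈ map inj₁ corePairs → ¬ (x ∈ map inj₂ stars)
    disjoint p p′ with ∈-map⁻ inj₁ p | ∈-map⁻ inj₂ p′
    ... | _ , _ , refl | _ , _ , ()

  hypergraph : UniformHypergraph k n
  hypergraph = record
    { edges    = map edge indices
    ; uniform  = All.map⁺ (All.tabulate (λ x∈ → ∣edge∣ (view x∈)))
    ; distinct = map⁺-∈ (λ x∈ y∈ → edge-injective (view x∈) (view y∈)) indices-unique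
    }

  length-edges : length (edges hypergraph) ≡ (ℓ C 2 ∸ 1) + r * (2 + m)
  length-edges = begin
    length (map edge indices)              ≡⟨ length-map edge indices ⟩
    length indices                         ≡⟨ length-++ (map inj₁ corePairs) ⟩
    length (map inj₁ corePairs) + length (map inj₂ stars)
      ≡⟨ cong₂ _+_ (length-map inj₁ corePairs) (length-map inj₂ stars) ⟩
    length corePairs + length stars
      ≡⟨ cong₂ _+_ (cong (_∸ 1) (length-pairs ℓ)) (length-cartesianProduct (allFin r) (allFin (2 + m))) ⟩
    (ℓ C 2 ∸ 1) + length (allFin r) * length (allFin (2 + m))
      ≡⟨ cong₂ (λ a b → (ℓ C 2 ∸ 1) + a * b) (length-tabulate {n = r} (λ i → i)) (length-tabulate {n = 2 + m} (λ i → i)) ⟩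
    (ℓ C 2 ∸ 1) + r * (2 + m)              ∎
    where open ≡-Reasoning

  -- Berge cliques described by edge labels

  record Clique : Set where
    field
      v               : Fin ℓ → Fin n
      v-injective     : Injective _≡_ _≡_ v
      label           : ∀ i j → i < j → Index
      label∈          : ∀ i j p → label i j p ∈ indices
      label-injective : ∀ {i j p i′ j′ p′} → label i j p ≡ label i′ j′ p′ → i ≡ i′ × j ≡ j′
      incident        : ∀ i j p → v i ∈ᵥ edge (label i j p) × v j ∈ᵥ edge (label i j p)

  -- Equal labels name equal edges, and these sit at equal positions of a duplicate-free list, so
  -- injectivity passes from positions to labels.
  clique : ContainsBergeK ℓ (edges hypergraph) → Clique
  clique (v , v-injective , φ , φ-injective , incident) = record
    { v               = v
    ; v-injective     = v-injective
    ; label           = λ i j p → proj₁ (preimage i j p)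
    ; label∈          = λ i j p → proj₁ (proj₂ (preimage i j p))
    ; label-injective = λ {i} {j} {p} {i′} {j′} {p′} eq → φ-injective i j p i′ j′ p′
        (lookup-injective (distinct hypergraph)
          (trans (lookup≡ i j p) (trans (cong edge eq) (sym (lookup≡ i′ j′ p′)))))
    ; incident        = λ i j p → subst (λ e → v i ∈ᵥ e × v j ∈ᵥ e) (lookup≡ i j p) (incident i j p)
    }
    where
    preimage : ∀ i j (p : i < j) → ∃ λ x → x ∈ indices × lookup (edges hypergraph) (φ i j p) ≡ edge x
    preimage i j p = ∈-map⁻ edge (∈-lookup (φ i j p))

    lookup≡ : ∀ i j p → lookup (edges hypergraph) (φ i j p) ≡ edge (proj₁ (preimage i j p))
    lookup≡ i j p = proj₂ (proj₂ (preimage i j p))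

  module _ (K : Clique) where
    open Clique K

    Labels : Fin ℓ → Fin ℓ → Index → Set
    Labels a b x = (Σ (a < b) λ p → label a b p ≡ x) ⊎ (Σ (b < a) λ p → label b a p ≡ x)

    unorderedLabel : ∀ a b → a ≢ b →
      ∃ λ x → x ∈ indices × (v a ∈ᵥ edge x × v b ∈ᵥ edge x) × Labels a b x
    unorderedLabel a b a≢b with <-cmp a b
    ... | tri< p _ _   = label a b p , label∈ a b p , incident a b p , inj₁ (p , refl)
    ... | tri≈ _ a≡b _ = contradiction a≡b a≢b
    ... | tri> _ _ p   = label b a p , label∈ b a p ,
                         (proj₂ (incident b a p) , proj₁ (incident b a p)) , inj₂ (p , refl)

    Labels-injective : ∀ {a b a′ b′ x} → Labels a b x → Labels a′ b′ x →
      (a ≡ a′ × b ≡ b′) ⊎ (a ≡ b′ × b ≡ a′)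
    Labels-injective (inj₁ (_ , eq)) (inj₁ (_ , eq′)) = inj₁ (label-injective (trans eq (sym eq′)))
    Labels-injective (inj₁ (_ , eq)) (inj₂ (_ , eq′)) = inj₂ (label-injective (trans eq (sym eq′)))
    Labels-injective (inj₂ (_ , eq)) (inj₁ (_ , eq′)) with b≡a′ , a≡b′ ← label-injective (trans eq (sym eq′)) =
      inj₂ (a≡b′ , b≡a′)
    Labels-injective (inj₂ (_ , eq)) (inj₂ (_ , eq′)) with b≡b′ , a≡a′ ← label-injective (trans eq (sym eq′)) =
      inj₁ (a≡a′ , b≡b′)

    -- Labels belong to unordered pairs, so the clique vertices may be renumbered. This brings two
    -- chosen vertices to positions 0 and 1.
    reindex : (π : Fin ℓ → Fin ℓ) → Injective _≡_ _≡_ π → Clique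
    reindex π π-injective = record
      { v               = v ∘ π
      ; v-injective     = π-injective ∘ v-injective
      ; label           = λ i j p → proj₁ (lab i j p)
      ; label∈          = λ i j p → proj₁ (proj₂ (lab i j p))
      ; incident        = λ i j p → proj₁ (proj₂ (proj₂ (lab i j p)))
      ; label-injective = λ {i} {j} {p} {i′} {j′} {p′} eq →
          ordered p p′ (Labels-injective (proj₂ (proj₂ (proj₂ (lab i j p))))
            (subst (Labels _ _) (sym eq) (proj₂ (proj₂ (proj₂ (lab i′ j′ p′))))))
      }
      where
      lab : ∀ i j → i < j → ∃ λ x → x ∈ indices × (v (π i) ∈ᵥ edge x × v (π j) ∈ᵥ edge x) × Labels (π i) (π j) x
      lab i j p = unorderedLabel (π i) (π j) (Fin.<⇒≢ p ∘ π-injective)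

      ordered : ∀ {i j i′ j′} → i < j → i′ < j′ →
        (π i ≡ π i′ × π j ≡ π j′) ⊎ (π i ≡ π j′ × π j ≡ π i′) → i ≡ i′ × j ≡ j′
      ordered p p′ (inj₁ (eq , eq′)) = π-injective eq , π-injective eq′
      ordered p p′ (inj₂ (eq , eq′)) with refl ← π-injective eq | refl ← π-injective eq′ =
        contradiction p (ℕ.<⇒≯ p′)

  -- Absence of a Berge clique

  outer∈edge : ∀ {x y} → View x → outerV y ∈ᵥ edge x → ∃₂ λ i g → x ≡ inj₂ (i , g) × y ∈ᵥ group g
  outer∈edge (left i)   y∈ = contradiction (outer∈⁻ {⁅ i ⁆} {spares∖0} y∈) ∉⊥
  outer∈edge (right i)  y∈ = contradiction (outer∈⁻ {⁅ i ⁆} {spares∖1} y∈) ∉⊥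
  outer∈edge (both {i} {j} _) y∈ = contradiction (outer∈⁻ {⁅ i ⁆ ∪ ⁅ j ⁆} {spares∖12} y∈) ∉⊥
  outer∈edge (star i g) y∈ = i , g , refl , outer∈⁻ {⁅ i ⁆} y∈

  Outer : Fin n → Set
  Outer z = ∃ λ y → z ≡ outerV y

  outer? : ∀ z → Dec (Outer z)
  outer? z with vertex z
  ... | core i  = no λ (y , eq) → core≢outer i y eq
  ... | spare x = no λ (y , eq) → spare≢outer x y eq
  ... | outer y = yes (y , refl)

  -- Hence a star serves no pair without an outer vertex, and all other neighbours of an outer
  -- vertex are core vertices.
  star-vertex : ∀ {z i g} → z ∈ᵥ edge (inj₂ (i , g)) → ¬ Outer z → z ≡ coreV i
  star-vertex {z} {i} z∈ ¬outer with vertex z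
  ... | core j  = cong coreV (x∈⁅y⁆⇒x≡y i (core∈⁻ {⁅ i ⁆} z∈))
  ... | spare x = contradiction (spare∈⁻ {⁅ i ⁆} z∈) ∉⊥
  ... | outer y = contradiction (y , refl) ¬outer

  -- Otherwise only core edges could be used, one fewer than there are pairs.
  some-outer : (K : Clique) → ∃ λ s → Outer (Clique.v K s)
  some-outer K with any? (λ s → outer? (Clique.v K s))
  ... | yes p  = p
  ... | no  ∄s = contradiction
    (injective-relation⇒≤ {R = R} (pairs-unique ℓ) R-injective R-total) ℕ.1+n≰n
    where
    open Clique K

    R : Fin ℓ × Fin ℓ → Fin ℓ × Fin ℓ → Set
    R (i , j) x = Σ (i < j) λ p → label i j p ≡ inj₁ x

    R-injective : ∀ {a b x} → R a x → R b x → a ≡ b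
    R-injective (_ , eq) (_ , eq′) with refl , refl ← label-injective (trans eq (sym eq′)) = refl

    R-total : ∀ {a} → a ∈ pairs ℓ → ∃ λ x → x ∈ corePairs × R a x
    R-total {i , j} ij∈ = go (label i j p) refl (label∈ i j p) (incident i j p)
      where
      p = ∈-pairs⁻ ij∈

      go : ∀ x → label i j p ≡ x → x ∈ indices → v i ∈ᵥ edge x × v j ∈ᵥ edge x →
           ∃ λ y → y ∈ corePairs × R (i , j) y
      -- A star would force both ends to be its core vertex.
      go (inj₂ (c , g)) _ _ (vi∈ , vj∈) = contradiction
        (v-injective (trans (star-vertex {g = g} vi∈ (λ o → ∄s (i , o)))
          (sym (star-vertex {g = g} vj∈ (λ o → ∄s (j , o))))))
        (Fin.<⇒≢ p)
      go (inj₁ y) eq x∈ _ with ∈-++⁻ (map inj₁ corePairs) x∈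
      ... | inj₁ q with _ , y∈ , refl ← ∈-map⁻ inj₁ q = y , y∈ , p , eq
      ... | inj₂ q with _ , _ , () ← ∈-map⁻ inj₂ q

  -- Otherwise the neighbours of v s would all be core vertices, of which there are too few.
  another-outer : (K : Clique) → ∀ s → Outer (Clique.v K s) → ∃ λ u → Outer (Clique.v K (punchIn s u))
  another-outer K s (y , vs≡) with any? (λ u → outer? (Clique.v K (punchIn s u)))
  ... | yes p  = p
  ... | no  ∄u = contradiction (injective⇒≤ {f = f} f-injective) ℕ.1+n≰n
    where
    open Clique K

    neighbour : ∀ u → ∃ λ i → v (punchIn s u) ≡ coreV i
    neighbour u with unorderedLabel K s (punchIn s u) (≢-sym (punchInᵢ≢i s u))
    ... | x , x∈ , (vs∈ , vu∈) , _ with outer∈edge (view x∈) (subst (_∈ᵥ edge x) vs≡ vs∈)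
    ...   | i , g , refl , _ = i , star-vertex {g = g} vu∈ (λ o → ∄u (u , o))

    f : Fin (suc r) → Fin r
    f u = proj₁ (neighbour u)

    f-injective : Injective _≡_ _≡_ f
    f-injective {a} {b} eq = punchIn-injective s a b (v-injective
      (trans (proj₂ (neighbour a)) (trans (cong coreV eq) (sym (proj₂ (neighbour b))))))

  -- All 2r + 1 pairs meeting {v 0 , v 1} would be labelled by stars on the
  -- at most two groups meeting {v 0 , v 1}, and there are only 2r of those.
  ¬two-outer : (K : Clique) → Outer (Clique.v K zero) → ¬ Outer (Clique.v K (suc zero))
  ¬two-outer K (y₀ , v₀≡) (y₁ , v₁≡) with
    outer∈edge (view (Clique.label∈ K zero (suc zero) (s≤s z≤n)))
      (subst (_∈ᵥ edge (Clique.label K zero (suc zero) (s≤s z≤n))) v₀≡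
        (proj₁ (Clique.incident K zero (suc zero) (s≤s z≤n))))
  -- The edge of the pair at positions 0 and 1 contains an outer vertex, so it is a star, and its
  -- group `g` contains both `y₀` and `y₁`.
  ... | i₀ , g , label≡ , y₀∈g = ℕ.1+n≰n (subst₂ _≤_ length-xs length-ys
      (injective-relation⇒≤ {R = R} xs-unique R-injective R-total))
    where
    open Clique K

    y₁∈g : y₁ ∈ᵥ group g
    y₁∈g = outer∈⁻ {⁅ i₀ ⁆} (subst₂ (λ z x → z ∈ᵥ edge x) v₁≡ label≡ (proj₂ (incident zero (suc zero) (s≤s z≤n))))

    g′ = proj₁ (overlapping g)

    rest : List (Fin ℓ)
    rest = map (λ i → suc (suc i)) (allFin r)

    ends : List (Fin ℓ)
    ends = zero ∷ suc zero ∷ []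

    xs : List (Fin ℓ × Fin ℓ)
    xs = (zero , suc zero) ∷ cartesianProduct ends rest

    ys : List (Fin r × Fin (2 + m))
    ys = cartesianProduct (allFin r) (g ∷ g′ ∷ [])

    length-allFin : length (allFin r) ≡ r
    length-allFin = length-tabulate {n = r} (λ i → i)

    length-xs : length xs ≡ suc (2 * r)
    length-xs = cong suc (trans (length-cartesianProduct ends rest)
      (cong (2 *_) (trans (length-map _ (allFin r)) length-allFin)))

    length-ys : length ys ≡ 2 * r
    length-ys = trans (length-cartesianProduct (allFin r) (g ∷ g′ ∷ []))
      (trans (cong (_* 2) length-allFin) (ℕ.*-comm r 2))

    xs-unique : Unique xs
    xs-unique = All.tabulate (λ { y∈ refl → 01∉ y∈ }) ∷ Unique.cartesianProduct⁺
      (((λ ()) ∷ []) ∷ [] ∷ []) (Unique.map⁺ (suc-injective ∘ suc-injective) (Unique.allFin⁺ r))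
      where
      01∉ : (zero , suc zero) ∉ cartesianProduct ends rest
      01∉ p with ∈-map⁻ _ (proj₂ (∈-cartesianProduct⁻ ends rest p))
      ... | _ , _ , ()

    R : Fin ℓ × Fin ℓ → Fin r × Fin (2 + m) → Set
    R (i , j) x = Σ (i < j) λ p → label i j p ≡ inj₂ x

    R-injective : ∀ {a b x} → R a x → R b x → a ≡ b
    R-injective (_ , eq) (_ , eq′) with refl , refl ← label-injective (trans eq (sym eq′)) = refl

    starLabel : ∀ {i y} → v i ≡ outerV y → y ∈ᵥ group g → ∀ j → i < j → ∃ λ x → x ∈ ys × R (i , j) x
    starLabel {i} vi≡ y∈g j p with
      outer∈edge (view (label∈ i j p)) (subst (_∈ᵥ edge (label i j p)) vi≡ (proj₁ (incident i j p)))
    ... | c , h , eq , y∈h with proj₂ (overlapping g) y∈g {h} y∈h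
    ...   | inj₁ refl = (c , h) , ∈-cartesianProduct⁺ (∈-allFin c) (here refl) , p , eq
    ...   | inj₂ refl = (c , h) , ∈-cartesianProduct⁺ (∈-allFin c) (there (here refl)) , p , eq

    R-total : ∀ {a} → a ∈ xs → ∃ λ x → x ∈ ys × R a x
    R-total (here refl) = starLabel v₀≡ y₀∈g (suc zero) (s≤s z≤n)
    R-total {i , j} (there ij∈) with ∈-cartesianProduct⁻ ends rest ij∈
    ... | i∈ , j∈ with ∈-map⁻ _ j∈
    R-total (there _) | here refl , _         | u , _ , refl = starLabel v₀≡ y₀∈g (suc (suc u)) (s≤s z≤n)
    R-total (there _) | there (here refl) , _ | u , _ , refl = starLabel v₁≡ y₁∈g (suc (suc u)) (s≤s (s≤s z≤n))

  berge-free : ¬ ContainsBergeK ℓ (edges hypergraph)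
  berge-free contains with some-outer (clique contains)
  ... | s , os with another-outer (clique contains) s os
  ...   | u , ou = ¬two-outer (reindex (clique contains) π π-injective) os ou
    where
    insert : ∀ {a} (s : Fin (suc a)) → (Fin a → Fin a) → Fin (suc a) → Fin (suc a)
    insert s f zero    = s
    insert s f (suc i) = punchIn s (f i)

    insert-injective : ∀ {a} (s : Fin (suc a)) {f} → Injective _≡_ _≡_ f → Injective _≡_ _≡_ (insert s f)
    insert-injective s inj {zero}  {zero}  _  = refl
    insert-injective s inj {zero}  {suc j} eq = contradiction (sym eq) (punchInᵢ≢i s _)
    insert-injective s inj {suc i} {zero}  eq = contradiction eq (punchInᵢ≢i s _)
    insert-injective s inj {suc i} {suc j} eq = cong suc (inj (punchIn-injective s _ _ eq))

    -- Positions 0 and 1 go to `s` and `punchIn s u`, where the two outer vertices are.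
    π : Fin ℓ → Fin ℓ
    π = insert s (insert u (λ i → i))

    π-injective : Injective _≡_ _≡_ π
    π-injective = insert-injective s (insert-injective u (λ eq → eq))

  -- Berge cliques that use a new edge

  edgeWith : Subset n → Maybe Index → Subset n
  edgeWith e = maybe′ edge e

  -- `nothing` stands for the new edge and is always valid.
  Valid : Maybe Index → Set
  Valid x = ∀ y → x ≡ just y → y ∈ indices

  module _ (e : Subset n) where

    position : ∀ x → Valid x → Fin (length (e ∷ edges hypergraph))
    position nothing  _  = zero
    position (just y) y∈ = suc (Any.index (∈-map⁺ edge (y∈ _ refl)))

    lookup-position : ∀ x x∈ → edgeWith e x ≡ lookup (e ∷ edges hypergraph) (position x x∈)
    lookup-position nothing  _  = refl
    lookup-position (just y) y∈ = lookup-index (∈-map⁺ edge (y∈ _ refl))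

    position-injective : ∀ x y x∈ y∈ → position x x∈ ≡ position y y∈ → x ≡ y
    position-injective nothing  nothing  _  _  _  = refl
    position-injective (just x) (just y) x∈ y∈ eq = cong just (edge-injective (view (x∈ _ refl)) (view (y∈ _ refl))
      (trans (lookup-position (just x) x∈)
        (trans (cong (lookup (e ∷ edges hypergraph)) eq) (sym (lookup-position (just y) y∈)))))

    -- The new edge is the head of the list and the labelled edges follow, so distinct valid labels
    -- get distinct positions and an injective labelling suffices.
    contains : (v : Fin ℓ → Fin n) → Injective _≡_ _≡_ v → (α : Fin ℓ → Fin ℓ → Maybe Index) →
      (∀ {i j} → i < j → Valid (α i j)) →
      (∀ {i j i′ j′} → i < j → i′ < j′ → α i j ≡ α i′ j′ → i ≡ i′ × j ≡ j′) →
      (∀ {i j} → i < j → v i ∈ᵥ edgeWith e (α i j) × v j ∈ᵥ edgeWith e (α i j)) →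
      ContainsBergeK ℓ (e ∷ edges hypergraph)
    contains v v-injective α valid α-injective incident =
      v , v-injective , (λ i j p → position (α i j) (valid p)) ,
      (λ i j p i′ j′ p′ eq → α-injective p p′ (position-injective _ _ (valid p) (valid p′) eq)) ,
      (λ i j p → subst (λ s → v i ∈ᵥ s × v j ∈ᵥ s) (lookup-position (α i j) (valid p)) (incident p))

  withCore : Fin n → Fin n → Fin ℓ → Fin n
  withCore x y zero          = x
  withCore x y (suc zero)    = y
  withCore x y (suc (suc i)) = coreV i

  withCore-injective : ∀ {x y} → x ≢ y → (∀ i → coreV i ≢ x) → (∀ i → coreV i ≢ y) →
    Injective _≡_ _≡_ (withCore x y)
  withCore-injective x≢y ≢x ≢y {zero}        {zero}        _  = refl
  withCore-injective x≢y ≢x ≢y {zero}        {suc zero}    eq = contradiction eq x≢y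
  withCore-injective x≢y ≢x ≢y {zero}        {suc (suc j)} eq = contradiction (sym eq) (≢x j)
  withCore-injective x≢y ≢x ≢y {suc zero}    {zero}        eq = contradiction (sym eq) x≢y
  withCore-injective x≢y ≢x ≢y {suc zero}    {suc zero}    _  = refl
  withCore-injective x≢y ≢x ≢y {suc zero}    {suc (suc j)} eq = contradiction (sym eq) (≢y j)
  withCore-injective x≢y ≢x ≢y {suc (suc i)} {zero}        eq = contradiction eq (≢x i)
  withCore-injective x≢y ≢x ≢y {suc (suc i)} {suc zero}    eq = contradiction eq (≢y i)
  withCore-injective x≢y ≢x ≢y {suc (suc i)} {suc (suc j)} eq = cong (λ i → suc (suc i)) (coreV-injective eq)

  -- Three ways to join a non-core vertex to the whole core with one edge per core vertex: by either
  -- kind of core edge with a single core vertex, or by the stars on one group.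
  data Link : Set where
    left right : Link
    star       : Fin (2 + m) → Link

  link : Link → Fin r → Index
  link left     i = inj₁ (zero , suc (suc i))
  link right    i = inj₁ (suc zero , suc (suc i))
  link (star g) i = inj₂ (i , g)

  link∈ : ∀ a i → link a i ∈ indices
  link∈ left     i = pair∈ (s≤s z≤n) λ ()
  link∈ right    i = pair∈ (s≤s (s≤s z≤n)) λ ()
  link∈ (star g) i = star∈ i g

  link-injective : ∀ a b {i j} → link a i ≡ link b j → a ≡ b × i ≡ j
  link-injective left     left     refl = refl , refl
  link-injective right    right    refl = refl , refl
  link-injective (star g) (star h) refl = refl , refl

  link≢both : ∀ a {i j j′} → link a i ≢ inj₁ (suc (suc j) , suc (suc j′))
  link≢both left     ()
  link≢both right    ()
  link≢both (star _) ()

  core∈link : ∀ a i → coreV i ∈ᵥ edge (link a i)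
  core∈link left     i = core∈⁺ (x∈⁅x⁆ i)
  core∈link right    i = core∈⁺ (x∈⁅x⁆ i)
  core∈link (star g) i = core∈⁺ (x∈⁅x⁆ i)

  record Linked (a : Link) (x : Fin n) : Set where
    constructor linked
    field
      ≢core : ∀ i → coreV i ≢ x
      ∈link : ∀ i → x ∈ᵥ edge (link a i)
  open Linked

  -- Different links use disjoint sets of edges, and each pair of core vertices has an edge of its
  -- own. Only the pair of `x` and `y` remains, and `e` serves it.
  join : ∀ {e x y a b} → x ≢ y → a ≢ b → Linked a x → Linked b y → x ∈ᵥ e → y ∈ᵥ e →
    ContainsBergeK ℓ (e ∷ edges hypergraph)
  join {e} {x} {y} {a} {b} x≢y a≢b lx ly x∈e y∈e =
    contains e (withCore x y) (withCore-injective x≢y (≢core lx) (≢core ly)) α valid α-injective incident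
    where
    α : Fin ℓ → Fin ℓ → Maybe Index
    α zero          (suc (suc i)) = just (link a i)
    α (suc zero)    (suc (suc i)) = just (link b i)
    α (suc (suc i)) (suc (suc j)) = just (inj₁ (suc (suc i) , suc (suc j)))
    -- Among increasing pairs only `(zero , suc zero)` arrives here.
    α _             _             = nothing

    valid : ∀ {i j} → i < j → Valid (α i j)
    valid {zero}        {suc (suc i)} _ _ refl = link∈ a i
    valid {suc zero}    {suc (suc i)} _ _ refl = link∈ b i
    valid {suc (suc i)} {suc (suc j)} p _ refl = pair∈ p λ ()
    valid {suc (suc i)} {suc zero}    (s≤s ())

    α-injective : ∀ {i j i′ j′} → i < j → i′ < j′ → α i j ≡ α i′ j′ → i ≡ i′ × j ≡ j′
    α-injective {zero} {suc zero} {zero} {suc zero} _ _ _ = refl , refl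
    α-injective {zero} {suc (suc i)} {zero} {suc (suc j)} _ _ eq
      with _ , refl ← link-injective a a {i} {j} (just-injective eq) = refl , refl
    α-injective {zero} {suc (suc i)} {suc zero} {suc (suc j)} _ _ eq =
      contradiction (proj₁ (link-injective a b (just-injective eq))) a≢b
    α-injective {suc zero} {suc (suc i)} {zero} {suc (suc j)} _ _ eq =
      contradiction (sym (proj₁ (link-injective b a (just-injective eq)))) a≢b
    α-injective {suc zero} {suc (suc i)} {suc zero} {suc (suc j)} _ _ eq
      with _ , refl ← link-injective b b {i} {j} (just-injective eq) = refl , refl
    α-injective {zero} {suc (suc i)} {suc (suc _)} {suc (suc j)} _ _ eq =
      contradiction (just-injective eq) (link≢both a)
    α-injective {suc zero} {suc (suc i)} {suc (suc _)} {suc (suc j)} _ _ eq =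
      contradiction (just-injective eq) (link≢both b)
    α-injective {suc (suc _)} {suc (suc i)} {zero} {suc (suc j)} _ _ eq =
      contradiction (sym (just-injective eq)) (link≢both a)
    α-injective {suc (suc _)} {suc (suc i)} {suc zero} {suc (suc j)} _ _ eq =
      contradiction (sym (just-injective eq)) (link≢both b)
    α-injective {suc (suc _)} {suc (suc i)} {suc (suc _)} {suc (suc j)} _ _ refl = refl , refl
    α-injective {suc zero} {suc zero} (s≤s ())
    α-injective {suc (suc _)} {suc zero} (s≤s ())
    α-injective {i′ = suc zero} {suc zero} _ (s≤s ())
    α-injective {i′ = suc (suc _)} {suc zero} _ (s≤s ())

    incident : ∀ {i j} → i < j → withCore x y i ∈ᵥ edgeWith e (α i j) × withCore x y j ∈ᵥ edgeWith e (α i j)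
    incident {zero}        {suc zero}    _ = x∈e , y∈e
    incident {zero}        {suc (suc i)} _ = ∈link lx i , core∈link a i
    incident {suc zero}    {suc (suc i)} _ = ∈link ly i , core∈link b i
    incident {suc (suc i)} {suc (suc j)} _ = core∈⁺ (x∈p∪q⁺ (inj₁ (x∈⁅x⁆ i))) ,
      core∈⁺ (x∈p∪q⁺ {p = ⁅ i ⁆} (inj₂ (x∈⁅x⁆ j)))
    incident {suc zero}    {suc zero}    (s≤s ())
    incident {suc (suc _)} {suc zero}    (s≤s ())

  -- The clique is on the core and two spare vertices.  As e takes over the pair
  -- {cᵢ , cⱼ}, the edge of that pair serves {spare 0 , cⱼ}, whose own edge then
  -- serves {spare 2 , spare 0}.
  core-pair : ∀ {e a b} → a < b → coreV a ∈ᵥ e → coreV b ∈ᵥ e →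
    ContainsBergeK ℓ (e ∷ edges hypergraph)
  core-pair {e} {a} {b} a<b a∈e b∈e =
    contains e (withCore x y) (withCore-injective x≢y (λ i → core≢spare i x′) (λ i → core≢spare i y′)) α
      valid α-injective incident
    where
    x′ y′ : Fin k
    -- Spare 2 lies in `spares∖0`, and both spare 2 and spare 0 lie in `spares∖1`, so the edge freed
    -- at `B` can join them.
    x′ = suc (suc zero)
    y′ = zero
    x y : Fin n
    x = spareV x′
    y = spareV y′

    x≢y : x ≢ y
    x≢y eq = case spareV-injective {x′} {y′} eq of λ ()

    A B : Fin ℓ
    A = suc (suc a)
    B = suc (suc b)

    isAB? : ∀ i j → Dec (i ≡ a × j ≡ b)
    isAB? i j = (i ≟ a) Dec.×-dec (j ≟ b)

    α : Fin ℓ → Fin ℓ → Maybe Index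
    α zero (suc zero)    = just (inj₁ (suc zero , B))
    α zero (suc (suc i)) = just (inj₁ (zero , suc (suc i)))
    α (suc zero) (suc (suc i)) with i ≟ b
    ... | yes _ = just (inj₁ (A , B))
    ... | no  _ = just (inj₁ (suc zero , suc (suc i)))
    α (suc (suc i)) (suc (suc j)) with isAB? i j
    ... | yes _ = nothing
    ... | no  _ = just (inj₁ (suc (suc i) , suc (suc j)))
    -- No increasing pair arrives here.
    α _ _ = nothing

    -- A left inverse on increasing pairs undoes the shift and so gives injectivity. `α` uses no
    -- stars, so their value is arbitrary.
    α⁻¹ : Maybe Index → Fin ℓ × Fin ℓ
    α⁻¹ nothing = A , B
    α⁻¹ (just (inj₁ (suc zero , suc (suc i)))) with i ≟ b
    ... | yes _ = zero , suc zero
    ... | no  _ = suc zero , suc (suc i)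
    α⁻¹ (just (inj₁ (suc (suc i) , suc (suc j)))) with isAB? i j
    ... | yes _ = suc zero , B
    ... | no  _ = suc (suc i) , suc (suc j)
    α⁻¹ (just (inj₁ ij)) = ij
    α⁻¹ (just (inj₂ _))  = A , B

    α⁻¹∘α : ∀ {i j} → i < j → α⁻¹ (α i j) ≡ (i , j)
    α⁻¹∘α {zero} {suc zero} _ with b ≟ b
    ... | yes _  = refl
    ... | no b≢b = contradiction refl b≢b
    α⁻¹∘α {zero} {suc (suc i)} _ = refl
    α⁻¹∘α {suc zero} {suc (suc i)} _ with i ≟ b
    α⁻¹∘α {suc zero} {suc (suc i)} _ | yes refl with isAB? a b
    ... | yes _ = refl
    ... | no ¬p = contradiction (refl , refl) ¬p
    α⁻¹∘α {suc zero} {suc (suc i)} _ | no i≢b with i ≟ b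
    ... | yes i≡b = contradiction i≡b i≢b
    ... | no _    = refl
    α⁻¹∘α {suc (suc i)} {suc (suc j)} _ with isAB? i j
    ... | yes (refl , refl) = refl
    ... | no ¬p with isAB? i j
    ...   | yes p = contradiction p ¬p
    ...   | no _  = refl
    α⁻¹∘α {suc zero}    {suc zero} (s≤s ())
    α⁻¹∘α {suc (suc _)} {suc zero} (s≤s ())

    α-injective : ∀ {i j i′ j′} → i < j → i′ < j′ → α i j ≡ α i′ j′ → i ≡ i′ × j ≡ j′
    α-injective p p′ eq with trans (sym (α⁻¹∘α p)) (trans (cong α⁻¹ eq) (α⁻¹∘α p′))
    ... | refl = refl , refl

    valid : ∀ {i j} → i < j → Valid (α i j)
    valid {zero} {suc zero} _ _ refl = pair∈ (s≤s (s≤s z≤n)) λ ()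
    valid {zero} {suc (suc i)} _ _ refl = pair∈ (s≤s z≤n) λ ()
    valid {suc zero} {suc (suc i)} _ _ eq with i ≟ b
    valid {suc zero} {suc (suc i)} _ _ refl | yes _ = pair∈ (s≤s (s≤s a<b)) λ ()
    valid {suc zero} {suc (suc i)} _ _ refl | no _  = pair∈ (s≤s (s≤s z≤n)) λ ()
    valid {suc (suc i)} {suc (suc j)} p _ eq with isAB? i j
    valid {suc (suc i)} {suc (suc j)} p _ refl | no _ = pair∈ p λ ()
    valid {suc (suc _)} {suc zero} (s≤s ())

    incident : ∀ {i j} → i < j → withCore x y i ∈ᵥ edgeWith e (α i j) × withCore x y j ∈ᵥ edgeWith e (α i j)
    incident {zero} {suc zero} _ = spare∈⁺ {⁅ b ⁆} (there (there here)) , spare∈⁺ {⁅ b ⁆} here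
    incident {zero} {suc (suc i)} _ = spare∈⁺ {⁅ i ⁆} (there (there here)) , core∈⁺ (x∈⁅x⁆ i)
    incident {suc zero} {suc (suc i)} _ with i ≟ b
    ... | yes refl = spare∈⁺ {⁅ a ⁆ ∪ ⁅ b ⁆} here , core∈⁺ (x∈p∪q⁺ {p = ⁅ a ⁆} (inj₂ (x∈⁅x⁆ b)))
    ... | no _     = spare∈⁺ {⁅ i ⁆} here , core∈⁺ (x∈⁅x⁆ i)
    incident {suc (suc i)} {suc (suc j)} _ with isAB? i j
    ... | yes (refl , refl) = a∈e , b∈e
    ... | no _ = core∈⁺ (x∈p∪q⁺ (inj₁ (x∈⁅x⁆ i))) ,
      core∈⁺ (x∈p∪q⁺ {p = ⁅ i ⁆} (inj₂ (x∈⁅x⁆ j)))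
    incident {suc zero}    {suc zero} (s≤s ())
    incident {suc (suc _)} {suc zero} (s≤s ())

  -- Saturation: cases according to the vertices of the new edge

  spare-left : ∀ x → x ≢ zero → Linked left (spareV x)
  spare-left x x≢0 = linked (λ i → core≢spare i x) (λ i → spare∈⁺ {⁅ i ⁆} (∈left x x≢0))
    where
    ∈left : ∀ x → x ≢ zero → x ∈ᵥ spares∖0
    ∈left zero                x≢0 = contradiction refl x≢0
    ∈left (suc zero)          _   = there here
    ∈left (suc (suc zero))    _   = there (there here)
    ∈left (suc (suc (suc x))) _   = there (there (there ∈⊤))

  spare-right : ∀ x → x ≢ suc zero → Linked right (spareV x)
  spare-right x x≢1 = linked (λ i → core≢spare i x) (λ i → spare∈⁺ {⁅ i ⁆} (∈right x x≢1))
    where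
    ∈right : ∀ x → x ≢ suc zero → x ∈ᵥ spares∖1
    ∈right zero                _   = here
    ∈right (suc zero)          x≢1 = contradiction refl x≢1
    ∈right (suc (suc zero))    _   = there (there here)
    ∈right (suc (suc (suc x))) _   = there (there (there ∈⊤))

  outer-star : ∀ {y g} → y ∈ᵥ group g → Linked (star g) (outerV y)
  outer-star {y} y∈g = linked (λ i → core≢outer i y) (λ i → outer∈⁺ {⁅ i ⁆} y∈g)

  -- Only spare 0 lacks the left link and only spare 1 the right one, so two distinct spare vertices
  -- can always be given different links.
  spare-pair : ∀ {e x y} → x ≢ y → spareV x ∈ᵥ e → spareV y ∈ᵥ e → ContainsBergeK ℓ (e ∷ edges hypergraph)
  spare-pair {x = zero} {y} x≢y x∈ y∈ = join (x≢y ∘ sym ∘ spareV-injective) (λ ())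
    (spare-left y (x≢y ∘ sym)) (spare-right zero λ ()) y∈ x∈
  spare-pair {x = suc x} {suc zero} x≢y x∈ y∈ = join (x≢y ∘ sym ∘ spareV-injective) (λ ())
    (spare-left (suc zero) λ ()) (spare-right (suc x) x≢y) y∈ x∈
  spare-pair {x = suc x} {zero} x≢y x∈ y∈ = join (x≢y ∘ spareV-injective) (λ ())
    (spare-left (suc x) λ ()) (spare-right zero λ ()) x∈ y∈
  spare-pair {x = suc x} {suc (suc y)} x≢y x∈ y∈ = join (x≢y ∘ spareV-injective) (λ ())
    (spare-left (suc x) λ ()) (spare-right (suc (suc y)) λ ()) x∈ y∈

  -- Each spare vertex has a left or a right link, and both differ from a star link.
  spare-outer : ∀ {e x y} → spareV x ∈ᵥ e → outerV y ∈ᵥ e → ContainsBergeK ℓ (e ∷ edges hypergraph)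
  spare-outer {x = zero}  {y} x∈ y∈ = join (spare≢outer zero y) (λ ())
    (spare-right zero λ ()) (outer-star {g = proj₁ (covered y)} (proj₂ (covered y))) x∈ y∈
  spare-outer {x = suc x} {y} x∈ y∈ = join (spare≢outer (suc x) y) (λ ())
    (spare-left (suc x) λ ()) (outer-star {g = proj₁ (covered y)} (proj₂ (covered y))) x∈ y∈

  -- Any group through `y` differs from `g`, so the two star links differ.
  outer-pair : ∀ {e x y g} → x ∈ᵥ group g → y ∉ᵥ group g → outerV x ∈ᵥ e → outerV y ∈ᵥ e →
    ContainsBergeK ℓ (e ∷ edges hypergraph)
  outer-pair {x = x} {y} {g} x∈g y∉g x∈ y∈ with h , y∈h ← covered y =
    join (λ eq → y∉g (subst (_∈ᵥ group g) (outerV-injective eq) x∈g))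
      (λ { refl → y∉g y∈h }) (outer-star {g = g} x∈g) (outer-star {g = h} y∈h) x∈ y∈

  module _ (a : Subset r) (b : Subset k) (c : Subset w) where
    private
      e = glue a b c

    ∈edges : ∀ {x} → x ∈ indices → edge x ≡ e → e ∈ edges hypergraph
    ∈edges x∈ eq = subst (_∈ edges hypergraph) eq (∈-map⁺ edge x∈)

    -- The sizes leave at least `q` outer vertices. Take a group through one of them: either some
    -- outer vertex of `e` avoids it and `outer-pair` applies, or `c` equals the group by size,
    -- which forces `t ≡ 1` and makes `e` a star already present.
    outer-case : ∀ {t} → ∣ a ∣ ≡ t → t ≤ 1 → t + ∣ c ∣ ≡ k →
      (∀ g → c ≡ group g → t ≡ 1 → e ∈ edges hypergraph) → e ∉ edges hypergraph →
      ContainsBergeK ℓ (e ∷ edges hypergraph)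
    outer-case {t} ∣a∣ t≤1 ∣e∣ star-edge e∉ = go (size c) refl
      where
      q≤∣c∣ : q ≤ ∣ c ∣
      q≤∣c∣ = ℕ.+-cancelˡ-≤ 1 q ∣ c ∣ (ℕ.≤-trans (ℕ.≤-reflexive (sym ∣e∣)) (ℕ.+-monoˡ-≤ ∣ c ∣ t≤1))

      decide : ∀ {y} → y ∈ᵥ c → ContainsBergeK ℓ (e ∷ edges hypergraph)
      decide {y} y∈c with covered y
      ... | g , y∈g with any? (λ z → (z ∈? c) Dec.×-dec Dec.¬? (z ∈? group g))
      ...   | yes (z , z∈c , z∉g) = outer-pair {g = g} y∈g z∉g (outer∈⁺ {a} {b} y∈c) (outer∈⁺ {a} {b} z∈c)
      ...   | no ∄z = contradiction (star-edge g c≡g t≡1) e∉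
        where
        c≡g : c ≡ group g
        c≡g = ⊆∧∣≥∣⇒≡ (λ {z} z∈c → Dec.decidable-stable (z ∈? group g) λ z∉g → ∄z (z , z∈c , z∉g))
          (ℕ.≤-trans (ℕ.≤-reflexive (∣group∣ g)) q≤∣c∣)

        t≡1 : t ≡ 1
        t≡1 = ℕ.+-cancelʳ-≡ q t 1 (trans (cong (t +_) (sym (trans (cong ∣_∣ c≡g) (∣group∣ g)))) ∣e∣)

      go : ∀ {p} → Size p → p ≡ c → ContainsBergeK ℓ (e ∷ edges hypergraph)
      go empty          refl = contradiction (subst (q ≤_) (∣⊥∣≡0 w) q≤∣c∣) λ ()
      go (singleton y)  refl = decide (x∈⁅x⁆ y)
      go (many _ y∈c _) refl = decide y∈c

  -- Two core or two spare vertices suffice at once. Otherwise there is at most one of each, and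
  -- `k ≥ 3` forces an outer vertex, to be paired with the spare vertex if there is one.
  saturated-glue : ∀ a b c → ∣ glue a b c ∣ ≡ k → glue a b c ∉ edges hypergraph →
    ContainsBergeK ℓ (glue a b c ∷ edges hypergraph)
  saturated-glue a b c ∣e∣ e∉ with size a | size b
  ... | many i<j i∈ j∈ | _ = core-pair i<j (core∈⁺ i∈) (core∈⁺ j∈)
  ... | _ | many i<j i∈ j∈ = spare-pair (Fin.<⇒≢ i<j) (spare∈⁺ {a} i∈) (spare∈⁺ {a} j∈)
  ... | empty | empty = outer-case ⊥ ⊥ c (∣⊥∣≡0 r) z≤n
        (trans (sym (trans (∣glue∣ ⊥ ⊥ c) (cong₂ (λ s t → s + (t + ∣ c ∣)) (∣⊥∣≡0 r) (∣⊥∣≡0 k)))) ∣e∣)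
        (λ _ _ ()) e∉
  ... | singleton i | empty = outer-case ⁅ i ⁆ ⊥ c (∣⁅x⁆∣≡1 i) ℕ.≤-refl
        (trans (sym (trans (∣glue∣ ⁅ i ⁆ ⊥ c) (cong₂ (λ s t → s + (t + ∣ c ∣)) (∣⁅x⁆∣≡1 i) (∣⊥∣≡0 k)))) ∣e∣)
        (λ g c≡g _ → ∈edges ⁅ i ⁆ ⊥ c (star∈ i g) (cong (glue ⁅ i ⁆ ⊥) (sym c≡g))) e∉
  ... | empty | singleton x with size c
  ...   | singleton y  = spare-outer (spare∈⁺ {⊥ {r}} (x∈⁅x⁆ x)) (outer∈⁺ {⊥ {r}} {⁅ x ⁆} (x∈⁅x⁆ y))
  ...   | many _ y∈ _  = spare-outer (spare∈⁺ {⊥ {r}} (x∈⁅x⁆ x)) (outer∈⁺ {⊥ {r}} {⁅ x ⁆} y∈)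
  ...   | empty        = contradiction (trans (sym ∣e∣) (trans (∣glue∣ ⊥ ⁅ x ⁆ ⊥)
          (cong₂ _+_ (∣⊥∣≡0 r) (cong₂ _+_ (∣⁅x⁆∣≡1 x) (∣⊥∣≡0 w))))) λ ()
  saturated-glue a b c ∣e∣ e∉ | singleton i | singleton x with size c
  ...   | singleton y  = spare-outer (spare∈⁺ {⁅ i ⁆} (x∈⁅x⁆ x)) (outer∈⁺ {⁅ i ⁆} {⁅ x ⁆} (x∈⁅x⁆ y))
  ...   | many _ y∈ _  = spare-outer (spare∈⁺ {⁅ i ⁆} (x∈⁅x⁆ x)) (outer∈⁺ {⁅ i ⁆} {⁅ x ⁆} y∈)
  ...   | empty        = contradiction (trans (sym ∣e∣) (trans (∣glue∣ ⁅ i ⁆ ⁅ x ⁆ ⊥)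
          (cong₂ _+_ (∣⁅x⁆∣≡1 i) (cong₂ _+_ (∣⁅x⁆∣≡1 x) (∣⊥∣≡0 w))))) λ ()

  saturated : BergeKSaturated ℓ hypergraph
  saturated = berge-free , λ e → case unglue e of λ { (a , b , c , refl) → saturated-glue a b c }

  -- The number of edges

  length-bound : q * length (edges hypergraph) ≤ r * n + q * (ℓ C 2 ∸ 1)
  length-bound = begin
    q * length (edges hypergraph)            ≡⟨ cong (q *_) (trans length-edges (ℕ.+-comm N (r * (2 + m)))) ⟩
    q * (r * (2 + m) + N)                    ≡⟨ ℕ.*-distribˡ-+ q (r * (2 + m)) N ⟩
    q * (r * (2 + m)) + q * N                ≡⟨ cong (_+ q * N) (solve 3 (λ q r m → q :* (r :* m) := r :* (q :* m)) refl q r (2 + m)) ⟩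
    r * (q * (2 + m)) + q * N                ≤⟨ ℕ.+-monoˡ-≤ (q * N) (ℕ.*-monoʳ-≤ r stars≤n) ⟩
    r * n + q * N                            ∎
    where
    open ℕ.≤-Reasoning
    open +-*-Solver
    N = ℓ C 2 ∸ 1

    -- All groups but group 0 are disjoint inside the outer vertices; the `q` points of group 0 are
    -- paid for by the `k` spare vertices.
    stars≤n : q * (2 + m) ≤ n
    stars≤n = begin
      q * (2 + m)           ≡⟨ ℕ.*-comm q (2 + m) ⟩
      q + suc m * q         ≤⟨ ℕ.+-mono-≤ (ℕ.n≤1+n q) (ℕ.m≤n+m (suc m * q) (suc ρ′)) ⟩
      k + w                 ≤⟨ ℕ.m≤n+m (k + w) r ⟩
      n                     ∎

  bound : SatUpperBound k ℓ n
  bound = hypergraph , saturated , length-bound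

-- Choice of the parameters for a given number of vertices

theorem3p9 : (k ℓ n : ℕ) → k ≥ 3 → ℓ ≥ 4 → n ≥ 10 * (k * k) * ℓ →
    SatUpperBound k ℓ n
theorem3p9 (suc (suc (suc k′))) (suc (suc r)) n (s≤s (s≤s (s≤s _))) (s≤s (s≤s _)) n≥ =
  subst (SatUpperBound k ℓ) (trans layout n≡) bound
  where
  q k ℓ d : ℕ
  q = 2 + k′
  k = suc q
  ℓ = 2 + r
  -- With both remaining parameters 0 there are `suc q` outer vertices. Dividing the surplus `d` by
  -- `q` yields the number of further groups and the extra length of the initial stretch.
  d = n ∸ (r + (k + suc q))

  open Construction r k′ (d / q) (d % q) (m%n<n d q) hiding (q; k; ℓ; n)

  k≤k*k*ℓ : k ≤ k * k * ℓ
  k≤k*k*ℓ = ℕ.≤-trans (ℕ.m≤m*n k k) (ℕ.m≤m*n (k * k) ℓ)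

  ℓ≤k*k*ℓ : ℓ ≤ k * k * ℓ
  ℓ≤k*k*ℓ = ℕ.m≤n*m ℓ (k * k)

  -- Each of the three summands, the last being `k` again, is at most `k * k * ℓ`.
  room : r + (k + suc q) ≤ n
  room = begin
    r + (k + k)                                     ≤⟨ ℕ.+-mono-≤ (ℕ.≤-trans (ℕ.m≤n+m r 2) ℓ≤k*k*ℓ)
                                                          (ℕ.+-mono-≤ k≤k*k*ℓ k≤k*k*ℓ) ⟩
    K + (K + K)                                     ≡⟨ cong (λ z → K + (K + z)) (sym (ℕ.+-identityʳ K)) ⟩
    3 * K                                           ≤⟨ ℕ.*-monoˡ-≤ K (ℕ.m≤m+n 3 7) ⟩
    10 * K                                          ≡⟨ sym (ℕ.*-assoc 10 (k * k) ℓ) ⟩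
    10 * (k * k) * ℓ                                ≤⟨ n≥ ⟩
    n                                               ∎
    where
    open ℕ.≤-Reasoning
    K = k * k * ℓ

  layout : r + (k + (suc (d % q) + suc (d / q) * q)) ≡ r + (k + suc q) + d
  layout = begin
    r + (k + (suc (d % q) + suc (d / q) * q))
      ≡⟨ solve 5 (λ r k q a b → r :+ (k :+ ((con 1 :+ a) :+ (q :+ b))) := r :+ (k :+ (con 1 :+ q)) :+ (a :+ b))
                 refl r k q (d % q) (d / q * q) ⟩
    r + (k + suc q) + (d % q + d / q * q)         ≡⟨ cong (r + (k + suc q) +_) (sym (m≡m%n+[m/n]*n d q)) ⟩
    r + (k + suc q) + d                           ∎
    where
    open ≡-Reasoning
    open +-*-Solver

  n≡ : r + (k + suc q) + d ≡ n
  n≡ = ℕ.m+[n∸m]≡n room
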